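{- For all integers $d,k\ge 1$ and every real $\delta>0$ there exists a constant $\alpha=\alpha(d,\delta,k)>0$ such that the following holds. Let $n\ge k$, let $P$ be a sequence of $n$ points in general position in $\mathbb{R}^d$, and let $\rho$ be a sequence of $k$ points in general position in $\mathbb{R}^d$. Suppose that there exist pairwise disjoint subsets $X_1,\dots,X_k$ of (the set of points of) $P$ such that: (i) $(X_1,\dots,X_k)$ has $\rho$-type transversals; and (ii) there exist at least $\delta\binom{n}{k}$ transversals to $(X_1,\dots,X_k)$ that are subsequences of $P$. Then there exist subsets $Y_1\subset X_1,\dots,Y_k\subset X_k$ such that: (a) each $Y_i$ has at least $\alpha\cdot n$ points; and (b) $(Y_1,\dots,Y_k)$ has $\rho$-type transversals with respect to $P$.
   Context: A set (or sequence) of points in $\mathbb{R}^d$ is in general position if no $j\le d+1$ of them lie in a common $(j-2)$-flat (in particular the points are distinct). The orientation of a $(d+1)$-tuple of points is $\chi(p_1,\dots,p_{d+1})=\operatorname{sgn}\det M$, where $M$ is the $(d+1)\times(d+1)$ matrix whose $i$-th row is $(1,p_i(1),\dots,p_i(d))$, with $p_i(j)$ the $j$-th coordinate of $p_i$. Two sequences $\sigma,\tau$ of $k$ points have the same labelled order type, $\sigma\simeq\tau$, if $\chi(\sigma(i_1),\dots,\sigma(i_{d+1}))=\chi(\tau(i_1),\dots,\tau(i_{d+1}))$ for all $1\le i_1<\cdots<i_{d+1}\le k$, where $\sigma(i)$ is the $i$-th entry of $\sigma$. A transversal to $(X_1,\dots,X_k)$ is a sequence $(x_1,\dots,x_k)$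 with $x_i\in X_i$ for every $i$. It is a subsequence of $P$ if the positions of $x_1,\dots,x_k$ in $P$ are strictly increasing. $(X_1,\dots,X_k)$ has $\rho$-type transversals if every transversal $\tau$ to it satisfies $\tau\simeq\rho$; it has $\rho$-type transversals with respect to $P$ if, in addition, every transversal is a subsequence of $P$. (No coloring is involved here.) -}

module Defs where

open import Algebra.Bundles.Raw using (RawRing)
import Algebra.Definitions.RawSemiring as RawSemiringDefs
open import Data.Fin.Base as Fin using (Fin; zero; suc; toℕ)
open import Data.Fin.Subset using (Subset; _∈_; _∩_; Empty)
open import Data.Integer.Base as ℤ using (+_)
open import Data.List.Base using (List; length)
open import Data.List.Relation.Unary.All using (All)
open import Data.List.Relation.Unary.Unique.Propositional using (Unique)
open import Data.Nat.Base as ℕ using (ℕ; zero; suc)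
import Data.Nat.Properties as ℕP
open import Data.Product.Base using (∃; _×_; _,_)
open import Data.Rational.Base as ℚ using (ℚ; 0ℚ; 1ℚ; ½; ∣_∣)
import Data.Rational.Properties as ℚP
open import Data.Rational.Solver using (module +-*-Solver)
open import Data.Vec.Base using (Vec; lookup)
open import Data.Vec.Functional using (Vector; removeAt) renaming (_∷_ to _∷ᵛ_)
open import Function.Base using (_∘_)
open import Function.Bundles using (_⇔_)
open import Level using (0ℓ)
open import Relation.Binary.Definitions using (Monotonic₁)
open import Relation.Binary.PropositionalEquality
open import Relation.Nullary.Negation using (¬_)

------------------------------------------------------------------------
-- Real numbers: rational Cauchy sequences, with equality and order
-- defined on the sequences

IsCauchy : (ℕ → ℚ) → Set
IsCauchy x = ∀ ε → 0ℚ ℚ.< ε →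
  ∃ λ N → ∀ m n → N ℕ.≤ m → N ℕ.≤ n → ∣ x m ℚ.- x n ∣ ℚ.≤ ε

record ℝ : Set where
  constructor mkℝ
  field
    seq    : ℕ → ℚ
    cauchy : IsCauchy seq

open ℝ public

infix 4 _≈_ _<_ _≤_

_≈_ : ℝ → ℝ → Set
x ≈ y = ∀ ε → 0ℚ ℚ.< ε →
  ∃ λ N → ∀ n → N ℕ.≤ n → ∣ seq x n ℚ.- seq y n ∣ ℚ.≤ ε

_<_ : ℝ → ℝ → Set
x < y = ∃ λ ε → 0ℚ ℚ.< ε ×
  ∃ λ N → ∀ n → N ℕ.≤ n → seq x n ℚ.+ ε ℚ.≤ seq y n

_≤_ : ℝ → ℝ → Set
x ≤ y = ∀ ε → 0ℚ ℚ.< ε →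
  ∃ λ N → ∀ n → N ℕ.≤ n → seq x n ℚ.≤ seq y n ℚ.+ ε

private
  abstract  -- the positivity checker is very slow if these unfold

    half-pos : ∀ ε → 0ℚ ℚ.< ε → 0ℚ ℚ.< ½ ℚ.* ε
    half-pos ε 0<ε =
      subst (ℚ._< ½ ℚ.* ε) (ℚP.*-zeroʳ ½) (ℚP.*-monoʳ-<-pos ½ 0<ε)

    half+half : ∀ ε → ½ ℚ.* ε ℚ.+ ½ ℚ.* ε ≡ ε
    half+half ε = trans (sym (ℚP.*-distribʳ-+ ε ½ ½)) (ℚP.*-identityˡ ε)

    +-rearrange : ∀ a b c d →
      (a ℚ.+ b) ℚ.- (c ℚ.+ d) ≡ (a ℚ.- c) ℚ.+ (b ℚ.- d)
    +-rearrange = solve 4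
      (λ a b c d → (a :+ b) :- (c :+ d) := (a :- c) :+ (b :- d)) refl
      where open +-*-Solver

    neg-rearrange : ∀ a b → (ℚ.- a) ℚ.- (ℚ.- b) ≡ ℚ.- (a ℚ.- b)
    neg-rearrange = solve 2 (λ a b → (:- a) :- (:- b) := :- (a :- b)) refl
      where open +-*-Solver

    *-rearrange : ∀ a b c d →
      a ℚ.* b ℚ.- c ℚ.* d ≡ a ℚ.* (b ℚ.- d) ℚ.+ (a ℚ.- c) ℚ.* d
    *-rearrange = solve 4
      (λ a b c d → a :* b :- c :* d := a :* (b :- d) :+ (a :- c) :* d) refl
      where open +-*-Solver

    split-off : ∀ a b → a ≡ (a ℚ.- b) ℚ.+ b
    split-off = solve 2 (λ a b → a := (a :- b) :+ b) refl
      where open +-*-Solver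

    const-cauchy : ∀ q → IsCauchy (λ _ → q)
    const-cauchy q ε 0<ε = 0 , λ _ _ _ _ →
      subst (λ r → ∣ r ∣ ℚ.≤ ε) (sym (ℚP.+-inverseʳ q)) (ℚP.<⇒≤ 0<ε)

    +-cauchy : ∀ x y → IsCauchy x → IsCauchy y → IsCauchy (λ n → x n ℚ.+ y n)
    +-cauchy x y cx cy ε 0<ε
      with cx (½ ℚ.* ε) (half-pos ε 0<ε) | cy (½ ℚ.* ε) (half-pos ε 0<ε)
    ... | N₁ , h₁ | N₂ , h₂ = N₁ ℕ.⊔ N₂ , λ m n N≤m N≤n → begin
      ∣ (x m ℚ.+ y m) ℚ.- (x n ℚ.+ y n) ∣
        ≡⟨ cong ∣_∣ (+-rearrange (x m) (y m) (x n) (y n)) ⟩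
      ∣ (x m ℚ.- x n) ℚ.+ (y m ℚ.- y n) ∣
        ≤⟨ ℚP.∣p+q∣≤∣p∣+∣q∣ (x m ℚ.- x n) (y m ℚ.- y n) ⟩
      ∣ x m ℚ.- x n ∣ ℚ.+ ∣ y m ℚ.- y n ∣
        ≤⟨ ℚP.+-mono-≤
             (h₁ m n (ℕP.m⊔n≤o⇒m≤o N₁ N₂ N≤m) (ℕP.m⊔n≤o⇒m≤o N₁ N₂ N≤n))
             (h₂ m n (ℕP.m⊔n≤o⇒n≤o N₁ N₂ N≤m) (ℕP.m⊔n≤o⇒n≤o N₁ N₂ N≤n)) ⟩
      ½ ℚ.* ε ℚ.+ ½ ℚ.* ε
        ≡⟨ half+half ε ⟩
      ε ∎
      where open ℚP.≤-Reasoning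

    neg-cauchy : ∀ x → IsCauchy x → IsCauchy (λ n → ℚ.- x n)
    neg-cauchy x cx ε 0<ε with cx ε 0<ε
    ... | N , h = N , λ m n N≤m N≤n → subst (ℚ._≤ ε)
      (sym (trans (cong ∣_∣ (neg-rearrange (x m) (x n)))
                  (ℚP.∣-p∣≡∣p∣ (x m ℚ.- x n))))
      (h m n N≤m N≤n)

    bounded : ∀ x → IsCauchy x →
      ∃ λ K → 0ℚ ℚ.< K × ∃ λ N → ∀ n → N ℕ.≤ n → ∣ x n ∣ ℚ.≤ K
    bounded x cx with cx 1ℚ (ℚP.positive⁻¹ 1ℚ)
    ... | N , h =
      1ℚ ℚ.+ ∣ x N ∣ ,
      ℚP.+-mono-<-≤ (ℚP.positive⁻¹ 1ℚ) (ℚP.0≤∣p∣ (x N)) ,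
      N , λ n N≤n → begin
        ∣ x n ∣                     ≡⟨ cong ∣_∣ (split-off (x n) (x N)) ⟩
        ∣ (x n ℚ.- x N) ℚ.+ x N ∣   ≤⟨ ℚP.∣p+q∣≤∣p∣+∣q∣ (x n ℚ.- x N) (x N) ⟩
        ∣ x n ℚ.- x N ∣ ℚ.+ ∣ x N ∣ ≤⟨ ℚP.+-monoˡ-≤ ∣ x N ∣ (h n N N≤n ℕP.≤-refl) ⟩
        1ℚ ℚ.+ ∣ x N ∣              ∎
      where open ℚP.≤-Reasoning

    *-mono-∣∣ : ∀ p q {a b} → 0ℚ ℚ.< a → ∣ p ∣ ℚ.≤ a → ∣ q ∣ ℚ.≤ b →
      ∣ p ℚ.* q ∣ ℚ.≤ a ℚ.* b
    *-mono-∣∣ p q {a} {b} 0<a p≤a q≤b = begin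
      ∣ p ℚ.* q ∣     ≡⟨ ℚP.∣p*q∣≡∣p∣*∣q∣ p q ⟩
      ∣ p ∣ ℚ.* ∣ q ∣ ≤⟨ ℚP.*-monoʳ-≤-nonNeg ∣ q ∣ {{ℚP.∣-∣-nonNeg q}} p≤a ⟩
      a ℚ.* ∣ q ∣     ≤⟨ ℚP.*-monoˡ-≤-nonNeg a {{ℚ.nonNegative (ℚP.<⇒≤ 0<a)}} q≤b ⟩
      a ℚ.* b         ∎
      where open ℚP.≤-Reasoning

    quotient : ∀ A B ε → 0ℚ ℚ.< A → 0ℚ ℚ.< B → 0ℚ ℚ.< ε →
      ∃ λ η → 0ℚ ℚ.< η × A ℚ.* η ℚ.+ η ℚ.* B ≡ ε
    quotient A B ε 0<A 0<B 0<ε = divide (A ℚ.+ B) refl (ℚP.+-mono-< 0<A 0<B)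
      where
      divide : ∀ K → K ≡ A ℚ.+ B → 0ℚ ℚ.< K →
        ∃ λ η → 0ℚ ℚ.< η × A ℚ.* η ℚ.+ η ℚ.* B ≡ ε
      divide K K≡A+B 0<K = η , 0<η , (begin
        A ℚ.* η ℚ.+ η ℚ.* B   ≡⟨ cong (ℚ._+ η ℚ.* B) (ℚP.*-comm A η) ⟩
        η ℚ.* A ℚ.+ η ℚ.* B   ≡⟨ ℚP.*-distribˡ-+ η A B ⟨
        η ℚ.* (A ℚ.+ B)       ≡⟨ cong (η ℚ.*_) K≡A+B ⟨
        ε ℚ.* K⁻¹ ℚ.* K       ≡⟨ ℚP.*-assoc ε K⁻¹ K ⟩
        ε ℚ.* (K⁻¹ ℚ.* K)     ≡⟨ cong (ε ℚ.*_) (ℚP.*-inverseˡ K {{K-nonZero}}) ⟩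
        ε ℚ.* 1ℚ              ≡⟨ ℚP.*-identityʳ ε ⟩
        ε                     ∎)
        where
        open ≡-Reasoning

        K-nonZero : ℚ.NonZero K
        K-nonZero = ℚP.pos⇒nonZero K {{ℚ.positive 0<K}}

        K⁻¹ η : ℚ
        K⁻¹ = ℚ.1/_ K {{K-nonZero}}
        η = ε ℚ.* K⁻¹

        0<η : 0ℚ ℚ.< η
        0<η = subst (ℚ._< η) (ℚP.*-zeroˡ K⁻¹)
          (ℚP.*-monoˡ-<-pos K⁻¹ {{ℚP.1/pos⇒pos K {{ℚ.positive 0<K}}}} 0<ε)

    *-close : ∀ p q r s {a b η ε} → 0ℚ ℚ.< a → 0ℚ ℚ.< η →
      a ℚ.* η ℚ.+ η ℚ.* b ≡ ε →
      ∣ p ∣ ℚ.≤ a → ∣ q ℚ.- s ∣ ℚ.≤ η → ∣ p ℚ.- r ∣ ℚ.≤ η → ∣ s ∣ ℚ.≤ b →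
      ∣ p ℚ.* q ℚ.- r ℚ.* s ∣ ℚ.≤ ε
    *-close p q r s {a} {b} {η} {ε} 0<a 0<η eq p≤a q≈s p≈r s≤b = begin
      ∣ p ℚ.* q ℚ.- r ℚ.* s ∣
        ≡⟨ cong ∣_∣ (*-rearrange p q r s) ⟩
      ∣ p ℚ.* (q ℚ.- s) ℚ.+ (p ℚ.- r) ℚ.* s ∣
        ≤⟨ ℚP.∣p+q∣≤∣p∣+∣q∣ (p ℚ.* (q ℚ.- s)) ((p ℚ.- r) ℚ.* s) ⟩
      ∣ p ℚ.* (q ℚ.- s) ∣ ℚ.+ ∣ (p ℚ.- r) ℚ.* s ∣
        ≤⟨ ℚP.+-mono-≤ (*-mono-∣∣ p (q ℚ.- s) 0<a p≤a q≈s)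
                       (*-mono-∣∣ (p ℚ.- r) s 0<η p≈r s≤b) ⟩
      a ℚ.* η ℚ.+ η ℚ.* b
        ≡⟨ eq ⟩
      ε ∎
      where open ℚP.≤-Reasoning

    *-cauchy : ∀ x y → IsCauchy x → IsCauchy y → IsCauchy (λ n → x n ℚ.* y n)
    *-cauchy x y cx cy ε 0<ε =
      let
        A , 0<A , Nx , hx = bounded x cx
        B , 0<B , Ny , hy = bounded y cy
        η , 0<η , eq      = quotient A B ε 0<A 0<B 0<ε
        N₁ , h₁           = cx η 0<η
        N₂ , h₂           = cy η 0<η
        M                 = Nx ℕ.⊔ Ny
        N                 = N₁ ℕ.⊔ N₂
      in M ℕ.⊔ N , λ m n M⊔N≤m M⊔N≤n →
        let
          M≤m = ℕP.m⊔n≤o⇒m≤o M N M⊔N≤m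
          N≤m = ℕP.m⊔n≤o⇒n≤o M N M⊔N≤m
          M≤n = ℕP.m⊔n≤o⇒m≤o M N M⊔N≤n
          N≤n = ℕP.m⊔n≤o⇒n≤o M N M⊔N≤n
        in *-close (x m) (y m) (x n) (y n) 0<A 0<η eq
             (hx m (ℕP.m⊔n≤o⇒m≤o Nx Ny M≤m))
             (h₂ m n (ℕP.m⊔n≤o⇒n≤o N₁ N₂ N≤m) (ℕP.m⊔n≤o⇒n≤o N₁ N₂ N≤n))
             (h₁ m n (ℕP.m⊔n≤o⇒m≤o N₁ N₂ N≤m) (ℕP.m⊔n≤o⇒m≤o N₁ N₂ N≤n))
             (hy n (ℕP.m⊔n≤o⇒n≤o Nx Ny M≤n))

fromℚ : ℚ → ℝ
fromℚ q = mkℝ (λ _ → q) (const-cauchy q)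

fromℕ : ℕ → ℝ
fromℕ n = fromℚ (+ n ℚ./ 1)

0ℝ 1ℝ : ℝ
0ℝ = fromℚ 0ℚ
1ℝ = fromℚ 1ℚ

infixl 6 _+_
infixl 7 _*_
infix  8 -_

_+_ : ℝ → ℝ → ℝ
mkℝ x cx + mkℝ y cy = mkℝ (λ n → x n ℚ.+ y n) (+-cauchy x y cx cy)

_*_ : ℝ → ℝ → ℝ
mkℝ x cx * mkℝ y cy = mkℝ (λ n → x n ℚ.* y n) (*-cauchy x y cx cy)

-_ : ℝ → ℝ
- mkℝ x cx = mkℝ (λ n → ℚ.- x n) (neg-cauchy x cx)

ℝ-rawRing : RawRing 0ℓ 0ℓ
ℝ-rawRing = record
  { Carrier = ℝ
  ; _≈_     = _≈_
  ; _+_     = _+_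
  ; _*_     = _*_
  ; -_      = -_
  ; 0#      = 0ℝ
  ; 1#      = 1ℝ
  }

open RawSemiringDefs (RawRing.rawSemiring ℝ-rawRing) public using (sum; _^_)

-- The sign of a real number is not a total function constructively (that
-- would decide x ≈ 0), so "sgn x = sgn y" is a relation.
SameSgn : ℝ → ℝ → Set
SameSgn x y =
  (0ℝ < x ⇔ 0ℝ < y) × (x ≈ 0ℝ ⇔ y ≈ 0ℝ) × (x < 0ℝ ⇔ y < 0ℝ)

Matrix : ℕ → Set
Matrix n = Vector (Vector ℝ n) n

-- Laplace expansion along the first row.
det : ∀ {n} → Matrix n → ℝ
det {zero}  M = 1ℝ
det {suc n} M = sum λ j →
  (- 1ℝ) ^ toℕ j * M zero j * det (λ i → removeAt (M (suc i)) j)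

------------------------------------------------------------------------
-- Points, flats and order types

Point : ℕ → Set
Point d = Vector ℝ d

StrictlyIncreasing : ∀ {m n} → (Fin m → Fin n) → Set
StrictlyIncreasing = Monotonic₁ Fin._<_ Fin._<_

LinearlyIndependent : ∀ {d m} → Vector (Point d) m → Set
LinearlyIndependent {d} {m} v = (c : Vector ℝ m) →
  (∀ a → sum (λ i → c i * v i a) ≈ 0ℝ) → ∀ i → c i ≈ 0ℝ

record Flat (d m : ℕ) : Set where
  field
    base        : Point d
    direction   : Vector (Point d) m
    independent : LinearlyIndependent direction

LiesIn : ∀ {d m} → Point d → Flat d m → Set
LiesIn {d} {m} p F = ∃ λ (t : Vector ℝ m) →
  ∀ a → p a ≈ base a + sum (λ i → t i * direction i a)
  where open Flat F

-- Here j = 2 + m; for j = 1 there is nothing to require, as the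
-- (-1)-flat is empty.
GeneralPosition : ∀ {d n} → Vector (Point d) n → Set
GeneralPosition {d} {n} P = ∀ m → 2 ℕ.+ m ℕ.≤ 1 ℕ.+ d →
  (ι : Fin (2 ℕ.+ m) → Fin n) → StrictlyIncreasing ι →
  ¬ (∃ λ (F : Flat d m) → ∀ i → LiesIn (P (ι i)) F)

-- χ is the sign of this determinant.
orientationDet : ∀ {d} → Vector (Point d) (suc d) → ℝ
orientationDet p = det (λ i → 1ℝ ∷ᵛ p i)

infix 4 _≃_

_≃_ : ∀ {d k} → Vector (Point d) k → Vector (Point d) k → Set
_≃_ {d} {k} σ τ = (ι : Fin (suc d) → Fin k) → StrictlyIncreasing ι →
  SameSgn (orientationDet (σ ∘ ι)) (orientationDet (τ ∘ ι))

------------------------------------------------------------------------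
-- Transversals.  The points of a sequence of length n in general position
-- are distinct, so a set of its points is given by the set of their
-- positions, and a sequence of its points by the vector of their positions.

PairwiseDisjoint : ∀ {n k} → Vector (Subset n) k → Set
PairwiseDisjoint X = ∀ i j → i ≢ j → Empty (X i ∩ X j)

IsTransversal : ∀ {n k} → Vector (Subset n) k → Vec (Fin n) k → Set
IsTransversal X τ = ∀ i → lookup τ i ∈ X i

IsSubsequence : ∀ {n k} → Vec (Fin n) k → Set
IsSubsequence τ = StrictlyIncreasing (lookup τ)

HasTypeTransversals : ∀ {d n k} →
  Vector (Point d) n → Vector (Point d) k → Vector (Subset n) k → Set
HasTypeTransversals P ρ X = ∀ τ → IsTransversal X τ → (P ∘ lookup τ) ≃ ρ

HasTypeTransversalsWrt : ∀ {d n k} →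
  Vector (Point d) n → Vector (Point d) k → Vector (Subset n) k → Set
HasTypeTransversalsWrt P ρ X =
  HasTypeTransversals P ρ X × (∀ τ → IsTransversal X τ → IsSubsequence τ)

AtLeast : {A : Set} → ℝ → (A → Set) → Set
AtLeast {A} r Q =
  ∃ λ (xs : List A) → Unique xs × All Q xs × r ≤ fromℕ (length xs)

{-# OPTIONS --safe #-}

-- Shrinking the Xᵢ preserves (i), so it suffices to find large Yᵢ ⊆ Xᵢ such
-- that all positions in Yᵢ precede all positions in Yᵢ₊₁.  Greedily take the
-- first t + 1 points of X₁, then the first t + 1 points of X₂ beyond those,
-- and so on.  If this gets stuck, every increasing transversal has, for some i,
-- its i-th point among the at most t points of Xᵢ that lie after the previous
-- cut and before the next one, so there are at most k t n^(k-1) of them.  For t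
-- a small fraction of n this is less than δ C(n,k).

module Submission where

open import Defs
open import Data.Fin.Subset using (Subset; _⊆_; ∣_∣)
open import Data.Nat.Base as ℕ using (ℕ)
open import Data.Nat.Combinatorics using (_C_)
open import Data.Product.Base using (∃; _×_)
open import Data.Vec.Functional using (Vector)

open import Data.Bool.Base using (T)
open import Data.Fin.Base as Fin using (Fin; zero; suc)
import Data.Fin.Properties as FinP
open import Data.Fin.Subset using (_∈_; _∩_; ⊥; inside; outside)
open import Data.Fin.Subset.Properties using (⊥⊆; ∉⊥; p∩q⊆p; p∩q⊆q; x∈p∩q⁺)
open import Data.Integer.Base as ℤ using (+_)
import Data.Integer.Properties as ℤP
open import Data.List.Base as List
  using (List; []; _∷_; [_]; _++_; length; map; allFin; cartesianProductWith)
open import Data.List.Membership.Propositional using () renaming (_∈_ to _∈ˡ_)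
open import Data.List.Membership.Propositional.Properties
  using (∈-map⁺; ∈-++⁺ˡ; ∈-++⁺ʳ; ∈-allFin; ∈-lookup; ∈-cartesianProductWith⁺)
open import Data.List.Properties using (length-++; length-map; length-tabulate)
open import Data.List.Relation.Unary.All as All using (All)
open import Data.List.Relation.Unary.AllPairs using (_∷_)
open import Data.List.Relation.Unary.Any using (here; there; index)
open import Data.List.Relation.Unary.Any.Properties using (lookup-index)
open import Data.List.Relation.Unary.Unique.Propositional using (Unique)
open import Data.Nat.Base using (zero; suc; z≤n; s≤s; z<s; s<s)
open import Data.Nat.Combinatorics
  using (nC1≡n; nCk+nC[k+1]≡[n+1]C[k+1]; k>n⇒nCk≡0)
open import Data.Nat.DivMod using (m/n*n≤m; m≡m%n+[m/n]*n; m%n<n)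
import Data.Nat.Properties as ℕP
open import Data.Nat.Solver using (module +-*-Solver)
open import Data.Product.Base using (_,_)
open import Data.Rational.Base as ℚ using (0ℚ; mkℚ; toℚᵘ)
import Data.Rational.Properties as ℚP
open import Data.Rational.Unnormalised.Base as ℚᵘ using (mkℚᵘ)
import Data.Rational.Unnormalised.Properties as ℚᵘP
open import Data.Sum.Base using (_⊎_; inj₁; inj₂)
open import Data.Vec.Base as Vec using (Vec; []; _∷_; here; there)
open import Data.Vec.Functional using () renaming (_∷_ to _∷ᵛ_)
open import Data.Vec.Properties using (lookup∘tabulate; lookup⇒[]=; []=⇒lookup)
open import Function.Base using (_∘_)
open import Relation.Binary.PropositionalEquality
  using (_≡_; refl; sym; trans; cong; cong₂; subst; module ≡-Reasoning)
open import Relation.Nullary.Decidable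
  using (does; yes; no; dec-true; toWitness; isYes≗does)
open import Relation.Nullary.Negation using (contradiction)

-- Counting with duplicate-free lists

lookup-injective : {A : Set} {xs : List A} → Unique xs → ∀ {i j} →
  List.lookup xs i ≡ List.lookup xs j → i ≡ j
lookup-injective (_ ∷ _)   {zero}  {zero}  _  = refl
lookup-injective (x∉ ∷ _)  {zero}  {suc j} eq =
  contradiction eq (All.lookup x∉ (∈-lookup j))
lookup-injective (x∉ ∷ _)  {suc i} {zero}  eq =
  contradiction (sym eq) (All.lookup x∉ (∈-lookup i))
lookup-injective (_ ∷ xs!) {suc i} {suc j} eq = cong suc (lookup-injective xs! eq)

-- Sending an index of `xs` to an index of the same entry in `ys` is injective: equal images give
-- equal entries, and `xs` has no repetitions.
unique⇒length≤ : {A : Set} {xs ys : List A} → Unique xs →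
  (∀ {x} → x ∈ˡ xs → x ∈ˡ ys) → length xs ℕ.≤ length ys
unique⇒length≤ {xs = xs} {ys} xs! xs⊆ys =
  FinP.injective⇒≤ {f = λ i → index (position i)} λ {i} {j} eq →
    lookup-injective xs! (trans (lookup-index (position i))
      (trans (cong (List.lookup ys) eq) (sym (lookup-index (position j)))))
  where
  position : ∀ i → List.lookup xs i ∈ˡ ys
  position i = xs⊆ys (∈-lookup i)

length-cartesianProductWith : {A B C : Set} (f : A → B → C) → ∀ xs ys →
  length (cartesianProductWith f xs ys) ≡ length xs ℕ.* length ys
length-cartesianProductWith f []       ys = refl
length-cartesianProductWith f (x ∷ xs) ys = trans
  (length-++ (map (f x) ys))
  (cong₂ ℕ._+_ (length-map (f x) ys) (length-cartesianProductWith f xs ys))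

allVecs : ∀ n k → List (Vec (Fin n) k)
allVecs n zero    = [ [] ]
allVecs n (suc k) = cartesianProductWith _∷_ (allFin n) (allVecs n k)

length-allVecs : ∀ n k → length (allVecs n k) ≡ n ℕ.^ k
length-allVecs n zero    = refl
length-allVecs n (suc k) = trans
  (length-cartesianProductWith _∷_ (allFin n) (allVecs n k))
  (cong₂ ℕ._*_ (length-tabulate {n = n} (λ i → i)) (length-allVecs n k))

∈-allVecs : ∀ {n k} (τ : Vec (Fin n) k) → τ ∈ˡ allVecs n k
∈-allVecs []      = here refl
∈-allVecs (x ∷ τ) = ∈-cartesianProductWith⁺ _∷_ (∈-allFin x) (∈-allVecs τ)

-- Initial segments of a set of positions

-- Restricting to later positions by intersection with this set keeps the ambient `n`, so that
-- recursion still speaks of positions in the original sequence.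
above : ∀ {n} → Fin n → Subset n
above c = Vec.tabulate λ x → does (c FinP.<? x)

∈-above⁺ : ∀ {n} {c x : Fin n} → c Fin.< x → x ∈ above c
∈-above⁺ {c = c} {x} c<x = lookup⇒[]= x (above c)
  (trans (lookup∘tabulate _ x) (dec-true (c FinP.<? x) c<x))

∈-above⁻ : ∀ {n} {c x : Fin n} → x ∈ above c → c Fin.< x
∈-above⁻ {c = c} {x} x∈ = toWitness {a? = c FinP.<? x} (subst T
  (trans (sym ([]=⇒lookup x∈))
    (trans (lookup∘tabulate _ x) (sym (isYes≗does (c FinP.<? x))))) _)

-- As built below, `cut` is the (t+1)-th smallest element of `X`, `part` runs up to and including
-- it, and `before` lists the t elements below it. `before` is an index so that its length bound
-- also serves when `X` is too small to have a cut.
record Initial {n} (X : Subset n) (t : ℕ) (before : List (Fin n)) : Set where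
  field
    cut        : Fin n
    part       : Subset n
    part⊆      : part ⊆ X
    large      : t ℕ.< ∣ part ∣
    ≤cut       : ∀ {x} → x ∈ part → x Fin.≤ cut
    before-cut : ∀ {x} → x ∈ X → x Fin.< cut → x ∈ˡ before

-- The scan runs from the left; `t` counts the elements that may still enter `before`, and the first
-- element met when it is zero becomes the cut. If no such element is met, `before` exhausts `X`.
initial : ∀ {n} (X : Subset n) t → ∃ λ before → length before ℕ.≤ t ×
  ((∀ {x} → x ∈ X → x ∈ˡ before) ⊎ Initial X t before)
initial []           t = [] , z≤n , inj₁ λ ()
initial (outside ∷ X) t with initial X t
... | xs , ∣xs∣≤t , inj₁ X⊆xs = map suc xs ,
  subst (ℕ._≤ t) (sym (length-map suc xs)) ∣xs∣≤t ,
  inj₁ λ { (there x∈X) → ∈-map⁺ suc (X⊆xs x∈X) }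
... | xs , ∣xs∣≤t , inj₂ I = map suc xs ,
  subst (ℕ._≤ t) (sym (length-map suc xs)) ∣xs∣≤t ,
  inj₂ record
    { cut        = suc cut
    ; part       = outside ∷ part
    ; part⊆      = λ { (there x∈) → there (part⊆ x∈) }
    ; large      = large
    ; ≤cut       = λ { (there x∈) → s≤s (≤cut x∈) }
    ; before-cut = λ { (there x∈X) (s<s x<c) → ∈-map⁺ suc (before-cut x∈X x<c) }
    }
  where open Initial I
initial (inside ∷ X) zero = [] , z≤n , inj₂ record
  { cut        = zero
  ; part       = inside ∷ ⊥
  ; part⊆      = λ { here → here ; (there x∈⊥) → there (⊥⊆ x∈⊥) }
  ; large      = z<s
  ; ≤cut       = λ { here → z≤n ; (there x∈⊥) → contradiction x∈⊥ ∉⊥ }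
  ; before-cut = λ _ ()
  }
initial (inside ∷ X) (suc t) with initial X t
... | xs , ∣xs∣≤t , inj₁ X⊆xs = zero ∷ map suc xs ,
  s≤s (subst (ℕ._≤ t) (sym (length-map suc xs)) ∣xs∣≤t) ,
  inj₁ λ { here → here refl ; (there x∈X) → there (∈-map⁺ suc (X⊆xs x∈X)) }
... | xs , ∣xs∣≤t , inj₂ I = zero ∷ map suc xs ,
  s≤s (subst (ℕ._≤ t) (sym (length-map suc xs)) ∣xs∣≤t) ,
  inj₂ record
    { cut        = suc cut
    ; part       = inside ∷ part
    ; part⊆      = λ { here → here ; (there x∈) → there (part⊆ x∈) }
    ; large      = s<s large
    ; ≤cut       = λ { here → z≤n ; (there x∈) → s≤s (≤cut x∈) }
    ; before-cut = λ { here _ → here refl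
                     ; (there x∈X) (s<s x<c) →
                         there (∈-map⁺ suc (before-cut x∈X x<c)) }
    }
  where open Initial I

-- The greedy choice of separated parts

Separated : ∀ {n k} → Vector (Subset n) k → Set
Separated Y = ∀ {i j} → i Fin.< j → ∀ {x y} → x ∈ Y i → y ∈ Y j → x Fin.< y

SeparatedParts : ∀ {n k} → Vector (Subset n) k → ℕ → Set
SeparatedParts X t = ∃ λ Y →
  (∀ i → Y i ⊆ X i) × (∀ i → t ℕ.< ∣ Y i ∣) × Separated Y

-- The bound is k t n^(k-1), multiplied by n to avoid the predecessor.
FewTransversals : ∀ {n k} → Vector (Subset n) k → ℕ → Set
FewTransversals {n} {k} X t = ∃ λ τs →
  n ℕ.* length τs ℕ.≤ k ℕ.* t ℕ.* n ℕ.^ k ×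
  (∀ {τ} → IsTransversal X τ → IsSubsequence τ → τ ∈ˡ τs)

-- Adding one set to the count: x n^k vectors start at one of x listed points and continue freely; n
-- l vectors start anywhere and continue in one of l ways.
few-step : ∀ {n t k x l} → x ℕ.≤ t → n ℕ.* l ℕ.≤ k ℕ.* t ℕ.* n ℕ.^ k →
  n ℕ.* (x ℕ.* n ℕ.^ k ℕ.+ n ℕ.* l) ℕ.≤ suc k ℕ.* t ℕ.* n ℕ.^ suc k
few-step {n} {t} {k} {x} {l} x≤t nl≤ = begin
  n ℕ.* (x ℕ.* n ℕ.^ k ℕ.+ n ℕ.* l)
    ≤⟨ ℕP.*-monoʳ-≤ n (ℕP.+-mono-≤ (ℕP.*-monoˡ-≤ (n ℕ.^ k) x≤t) nl≤) ⟩
  n ℕ.* (t ℕ.* n ℕ.^ k ℕ.+ k ℕ.* t ℕ.* n ℕ.^ k)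
    ≡⟨ solve 4 (λ n t k p →
         n :* (t :* p :+ k :* t :* p) := (t :+ k :* t) :* (n :* p))
         refl n t k (n ℕ.^ k) ⟩
  suc k ℕ.* t ℕ.* n ℕ.^ suc k ∎
  where
  open ℕP.≤-Reasoning
  open +-*-Solver

-- Induction on `k`: the first set is cut by `initial`, and the hypothesis is applied to the other
-- sets, restricted to positions beyond the cut.
separatedParts⊎fewTransversals : ∀ {n k} (X : Vector (Subset n) k) t →
  SeparatedParts X t ⊎ FewTransversals X t
separatedParts⊎fewTransversals {n} {zero} X t =
  inj₁ ((λ ()) , (λ ()) , (λ ()) , λ {i} → λ { {()} })
separatedParts⊎fewTransversals {n} {suc k} X t with initial (X zero) t
-- The first set has at most `t` points, so prescribing the first entry alone already covers every
-- transversal.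
... | xs , ∣xs∣≤t , inj₁ X₀⊆xs = inj₂
  ( cartesianProductWith _∷_ xs (allVecs n k)
  , bound
  , λ { {x ∷ τ} τ∈X _ →
          ∈-cartesianProductWith⁺ _∷_ (X₀⊆xs (τ∈X zero)) (∈-allVecs τ) } )
  where
  bound : n ℕ.* length (cartesianProductWith _∷_ xs (allVecs n k))
    ℕ.≤ suc k ℕ.* t ℕ.* n ℕ.^ suc k
  -- This is `few-step` with `l` = 0, since no vectors of the second kind occur; hence the term
  -- `n ℕ.* 0`.
  bound = subst (λ l → n ℕ.* l ℕ.≤ suc k ℕ.* t ℕ.* n ℕ.^ suc k)
    (begin
      length xs ℕ.* n ℕ.^ k ℕ.+ n ℕ.* 0
        ≡⟨ cong (length xs ℕ.* n ℕ.^ k ℕ.+_) (ℕP.*-zeroʳ n) ⟩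
      length xs ℕ.* n ℕ.^ k ℕ.+ 0
        ≡⟨ ℕP.+-identityʳ _ ⟩
      length xs ℕ.* n ℕ.^ k
        ≡⟨ cong (length xs ℕ.*_) (length-allVecs n k) ⟨
      length xs ℕ.* length (allVecs n k)
        ≡⟨ length-cartesianProductWith _∷_ xs (allVecs n k) ⟨
      length (cartesianProductWith _∷_ xs (allVecs n k)) ∎)
    (few-step {n} {t} {k} {length xs} {0} ∣xs∣≤t
      (subst (ℕ._≤ k ℕ.* t ℕ.* n ℕ.^ k) (sym (ℕP.*-zeroʳ n)) z≤n))
    where open ≡-Reasoning
... | xs , ∣xs∣≤t , inj₂ I
  with separatedParts⊎fewTransversals (λ i → X (suc i) ∩ above (Initial.cut I)) t
... | inj₁ (Y , Y⊆ , t<∣Y∣ , Y-separated) = inj₁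
  ( part ∷ᵛ Y
  , (λ { zero → part⊆ ; (suc i) → p∩q⊆p (X (suc i)) (above cut) ∘ Y⊆ i })
  , (λ { zero → large ; (suc i) → t<∣Y∣ i })
  , λ {i} {j} → separated i j )
  where
  open Initial I
  separated : ∀ i j → i Fin.< j → ∀ {x y} →
    x ∈ (part ∷ᵛ Y) i → y ∈ (part ∷ᵛ Y) j → x Fin.< y
  separated zero    (suc j) _         x∈ y∈ = ℕP.≤-<-trans (≤cut x∈)
    (∈-above⁻ (p∩q⊆q (X (suc j)) (above cut) (Y⊆ j y∈)))
  separated (suc i) (suc j) (s<s i<j) x∈ y∈ = Y-separated i<j x∈ y∈
-- The two lists cover the increasing transversals that start before `cut` and those that start at
-- or after it.
... | inj₂ (τs , few , covers) = inj₂
  ( cartesianProductWith _∷_ xs (allVecs n k) ++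
    cartesianProductWith _∷_ (allFin n) τs
  , subst (λ l → n ℕ.* l ℕ.≤ suc k ℕ.* t ℕ.* n ℕ.^ suc k) (sym length-eq)
      (few-step {n} {t} {k} {length xs} {length τs} ∣xs∣≤t few)
  , λ {τ} → covered τ )
  where
  open Initial I

  length-eq : length (cartesianProductWith _∷_ xs (allVecs n k) ++
                      cartesianProductWith _∷_ (allFin n) τs)
    ≡ length xs ℕ.* n ℕ.^ k ℕ.+ n ℕ.* length τs
  length-eq = begin
    length (cartesianProductWith _∷_ xs (allVecs n k) ++
            cartesianProductWith _∷_ (allFin n) τs)
      ≡⟨ length-++ (cartesianProductWith _∷_ xs (allVecs n k)) ⟩
    length (cartesianProductWith _∷_ xs (allVecs n k)) ℕ.+
    length (cartesianProductWith _∷_ (allFin n) τs)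
      ≡⟨ cong₂ ℕ._+_ (length-cartesianProductWith _∷_ xs (allVecs n k))
                     (length-cartesianProductWith _∷_ (allFin n) τs) ⟩
    length xs ℕ.* length (allVecs n k) ℕ.+ length (allFin n) ℕ.* length τs
      ≡⟨ cong₂ (λ a b → length xs ℕ.* a ℕ.+ b ℕ.* length τs)
           (length-allVecs n k) (length-tabulate {n = n} (λ i → i)) ⟩
    length xs ℕ.* n ℕ.^ k ℕ.+ n ℕ.* length τs ∎
    where open ≡-Reasoning

  covered : ∀ τ → IsTransversal X τ → IsSubsequence τ →
    τ ∈ˡ cartesianProductWith _∷_ xs (allVecs n k) ++
         cartesianProductWith _∷_ (allFin n) τs
  covered (x ∷ τ) τ∈X τ< with x FinP.<? cut
  ... | yes x<c = ∈-++⁺ˡ (∈-cartesianProductWith⁺ _∷_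
          (before-cut (τ∈X zero) x<c) (∈-allVecs τ))
  -- Since x is at or beyond `cut`, monotonicity puts all later entries strictly beyond it, so the
  -- tail is a transversal to the restricted sets.
  ... | no x≮c = ∈-++⁺ʳ _ (∈-cartesianProductWith⁺ _∷_ (∈-allFin x)
          (covers
            (λ i → x∈p∩q⁺ (τ∈X (suc i) ,
              ∈-above⁺ (ℕP.≤-<-trans (ℕP.≮⇒≥ x≮c) (τ< {zero} {suc i} z<s))))
            (λ i<j → τ< (s<s i<j))))

-- Comparison of n^k with the binomial coefficient

-- The absorption identity: Pascal's rule splits the left side, induction rewrites both summands,
-- and Pascal's rule recombines them.
[1+k]*[1+n]C[1+k] : ∀ n k → suc k ℕ.* (suc n C suc k) ≡ suc n ℕ.* (n C k)
[1+k]*[1+n]C[1+k] n       zero    = trans (ℕP.*-identityˡ _)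
  (trans (nC1≡n (suc n)) (sym (ℕP.*-identityʳ (suc n))))
[1+k]*[1+n]C[1+k] zero    (suc k) = begin
  suc (suc k) ℕ.* (1 C suc (suc k))
    ≡⟨ cong (suc (suc k) ℕ.*_) (k>n⇒nCk≡0 {1} {suc (suc k)} (s<s z<s)) ⟩
  suc (suc k) ℕ.* 0
    ≡⟨ ℕP.*-zeroʳ (suc (suc k)) ⟩
  0
    ≡⟨ cong (1 ℕ.*_) (k>n⇒nCk≡0 {0} {suc k} z<s) ⟨
  1 ℕ.* (0 C suc k) ∎
  where open ≡-Reasoning
[1+k]*[1+n]C[1+k] (suc n) (suc k) = begin
  suc (suc k) ℕ.* (suc (suc n) C suc (suc k))
    ≡⟨ cong (suc (suc k) ℕ.*_) (nCk+nC[k+1]≡[n+1]C[k+1] (suc n) (suc k)) ⟨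
  suc (suc k) ℕ.* ((suc n C suc k) ℕ.+ (suc n C suc (suc k)))
    ≡⟨ ℕP.*-distribˡ-+ (suc (suc k)) (suc n C suc k) _ ⟩
  (suc n C suc k) ℕ.+ suc k ℕ.* (suc n C suc k) ℕ.+
  suc (suc k) ℕ.* (suc n C suc (suc k))
    ≡⟨ cong₂ (λ a b → (suc n C suc k) ℕ.+ a ℕ.+ b)
         ([1+k]*[1+n]C[1+k] n k) ([1+k]*[1+n]C[1+k] n (suc k)) ⟩
  (suc n C suc k) ℕ.+ suc n ℕ.* (n C k) ℕ.+ suc n ℕ.* (n C suc k)
    ≡⟨ ℕP.+-assoc (suc n C suc k) _ _ ⟩
  (suc n C suc k) ℕ.+ (suc n ℕ.* (n C k) ℕ.+ suc n ℕ.* (n C suc k))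
    ≡⟨ cong ((suc n C suc k) ℕ.+_) (ℕP.*-distribˡ-+ (suc n) (n C k) _) ⟨
  (suc n C suc k) ℕ.+ suc n ℕ.* ((n C k) ℕ.+ (n C suc k))
    ≡⟨ cong (λ c → (suc n C suc k) ℕ.+ suc n ℕ.* c) (nCk+nC[k+1]≡[n+1]C[k+1] n k) ⟩
  suc (suc n) ℕ.* (suc n C suc k) ∎
  where open ≡-Reasoning

-- Factor by factor, 1 + n ≤ 2n; for k ≥ 1 the hypothesis k ≤ n gives n ≥ 1.
[1+n]^k≤2^k*n^k : ∀ n k → k ℕ.≤ n → suc n ℕ.^ k ℕ.≤ 2 ℕ.^ k ℕ.* n ℕ.^ k
[1+n]^k≤2^k*n^k n         zero    _   = ℕP.≤-refl
[1+n]^k≤2^k*n^k n@(suc m) (suc k) k<n = begin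
  suc n ℕ.* suc n ℕ.^ k
    ≤⟨ ℕP.*-mono-≤ (s≤s (ℕP.m≤n+m n m)) ([1+n]^k≤2^k*n^k n k (ℕP.<⇒≤ k<n)) ⟩
  (n ℕ.+ n) ℕ.* (2 ℕ.^ k ℕ.* n ℕ.^ k)
    ≡⟨ solve 3 (λ n a b → (n :+ n) :* (a :* b) := con 2 :* a :* (n :* b))
         refl n (2 ℕ.^ k) (n ℕ.^ k) ⟩
  2 ℕ.^ suc k ℕ.* n ℕ.^ suc k ∎
  where
  open ℕP.≤-Reasoning
  open +-*-Solver

-- Chosen before n, `K` can enter the final constant. In the induction, passing from (1+n)^k to n^k
-- costs 2^k, and absorption costs k + 1.
n^k≤K*nCk : ∀ k → ∃ λ K → ∀ n → k ℕ.≤ n → n ℕ.^ k ℕ.≤ K ℕ.* (n C k)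
n^k≤K*nCk zero = 1 , λ _ _ → ℕP.≤-refl
n^k≤K*nCk (suc k) with n^k≤K*nCk k
... | K , n^k≤ = 2 ℕ.^ k ℕ.* K ℕ.* suc k , λ { (suc n) (s≤s k≤n) → begin
  suc n ℕ.* suc n ℕ.^ k
    ≤⟨ ℕP.*-monoʳ-≤ (suc n) ([1+n]^k≤2^k*n^k n k k≤n) ⟩
  suc n ℕ.* (2 ℕ.^ k ℕ.* n ℕ.^ k)
    ≤⟨ ℕP.*-monoʳ-≤ (suc n) (ℕP.*-monoʳ-≤ (2 ℕ.^ k) (n^k≤ n k≤n)) ⟩
  suc n ℕ.* (2 ℕ.^ k ℕ.* (K ℕ.* (n C k)))
    ≡⟨ solve 4 (λ a b c d → a :* (b :* (c :* d)) := b :* c :* (a :* d))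
         refl (suc n) (2 ℕ.^ k) K (n C k) ⟩
  2 ℕ.^ k ℕ.* K ℕ.* (suc n ℕ.* (n C k))
    ≡⟨ cong (2 ℕ.^ k ℕ.* K ℕ.*_) ([1+k]*[1+n]C[1+k] n k) ⟨
  2 ℕ.^ k ℕ.* K ℕ.* (suc k ℕ.* (suc n C suc k))
    ≡⟨ ℕP.*-assoc (2 ℕ.^ k ℕ.* K) (suc k) _ ⟨
  2 ℕ.^ k ℕ.* K ℕ.* suc k ℕ.* (suc n C suc k) ∎ }
  where
  open ℕP.≤-Reasoning
  open +-*-Solver

-- Unit fractions and rational bounds for reals

-- Unnormalised rationals are compared by cross-multiplication, so no gcd has to be computed.
toℚᵘ-unitFraction* : ∀ a n →
  toℚᵘ ((+ 1 ℚ./ suc a) ℚ.* (+ n ℚ./ 1)) ℚᵘ.≃ mkℚᵘ (+ n) a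
toℚᵘ-unitFraction* a n = begin-equality
  toℚᵘ ((+ 1 ℚ./ suc a) ℚ.* (+ n ℚ./ 1))
    ≃⟨ ℚP.toℚᵘ-homo-* (+ 1 ℚ./ suc a) (+ n ℚ./ 1) ⟩
  toℚᵘ (+ 1 ℚ./ suc a) ℚᵘ.* toℚᵘ (+ n ℚ./ 1)
    ≃⟨ ℚᵘP.*-cong (ℚP.toℚᵘ-fromℚᵘ (mkℚᵘ (+ 1) a)) (ℚP.toℚᵘ-fromℚᵘ (mkℚᵘ (+ n) 0)) ⟩
  mkℚᵘ (+ 1) a ℚᵘ.* mkℚᵘ (+ n) 0
    ≃⟨ ℚᵘ.*≡* (cong₂ ℤ._*_ (ℤP.*-identityˡ (+ n))
         (cong +_ (sym (ℕP.*-identityʳ (suc a))))) ⟩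
  mkℚᵘ (+ n) a ∎
  where open ℚᵘP.≤-Reasoning

unitFraction*≤⁺ : ∀ a n y → n ℕ.≤ y ℕ.* suc a →
  (+ 1 ℚ./ suc a) ℚ.* (+ n ℚ./ 1) ℚ.≤ + y ℚ./ 1
unitFraction*≤⁺ a n y n≤ = ℚP.toℚᵘ-cancel-≤ (begin
  toℚᵘ ((+ 1 ℚ./ suc a) ℚ.* (+ n ℚ./ 1)) ≃⟨ toℚᵘ-unitFraction* a n ⟩
  mkℚᵘ (+ n) a                           ≤⟨ ℚᵘ.*≤* n≤ᶻ ⟩
  mkℚᵘ (+ y) 0                           ≃⟨ ℚP.toℚᵘ-fromℚᵘ (mkℚᵘ (+ y) 0) ⟨
  toℚᵘ (+ y ℚ./ 1)                       ∎)
  where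
  open ℚᵘP.≤-Reasoning
  n≤ᶻ : + n ℤ.* + 1 ℤ.≤ + y ℤ.* + suc a
  n≤ᶻ = subst (ℤ._≤ + y ℤ.* + suc a) (sym (ℤP.*-identityʳ (+ n)))
    (subst (+ n ℤ.≤_) (ℤP.pos-* y (suc a)) (ℤ.+≤+ n≤))

unitFraction*≤⁻ : ∀ a n y →
  (+ 1 ℚ./ suc a) ℚ.* (+ n ℚ./ 1) ℚ.≤ + y ℚ./ 1 → n ℕ.≤ y ℕ.* suc a
unitFraction*≤⁻ a n y p≤q = ℤP.drop‿+≤+
  (subst (+ n ℤ.≤_) (sym (ℤP.pos-* y (suc a)))
    (subst (ℤ._≤ + y ℤ.* + suc a) (ℤP.*-identityʳ (+ n)) (ℚᵘP.drop-*≤* n/a≤y)))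
  where
  open ℚᵘP.≤-Reasoning
  n/a≤y : mkℚᵘ (+ n) a ℚᵘ.≤ mkℚᵘ (+ y) 0
  n/a≤y = begin
    mkℚᵘ (+ n) a                           ≃⟨ toℚᵘ-unitFraction* a n ⟨
    toℚᵘ ((+ 1 ℚ./ suc a) ℚ.* (+ n ℚ./ 1)) ≤⟨ ℚP.toℚᵘ-mono-≤ p≤q ⟩
    toℚᵘ (+ y ℚ./ 1)                       ≃⟨ ℚP.toℚᵘ-fromℚᵘ (mkℚᵘ (+ y) 0) ⟩
    mkℚᵘ (+ y) 0                           ∎

0<unitFraction : ∀ a → 0ℚ ℚ.< + 1 ℚ./ suc a
0<unitFraction a = ℚP.positive⁻¹ (+ 1 ℚ./ suc a) {{ℚP.normalize-pos 1 (suc a)}}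

-- The denominator of ε itself serves, as its numerator is at least 1.
unitFraction≤ : ∀ ε → 0ℚ ℚ.< ε → ∃ λ a → + 1 ℚ./ suc a ℚ.≤ ε
unitFraction≤ ε@(mkℚ _ a _) 0<ε = a , ℚP.toℚᵘ-cancel-≤ (begin
  toℚᵘ (+ 1 ℚ./ suc a) ≃⟨ ℚP.toℚᵘ-fromℚᵘ (mkℚᵘ (+ 1) a) ⟩
  mkℚᵘ (+ 1) a         ≤⟨ ℚᵘ.*≤* (ℤP.*-monoʳ-≤-nonNeg (+ suc a)
                            (ℤP.i<j⇒suc[i]≤j 0<↥ε)) ⟩
  toℚᵘ ε               ∎)
  where
  open ℚᵘP.≤-Reasoning
  0<↥ε : + 0 ℤ.< ℚ.↥ ε
  0<↥ε = ℤP.positive⁻¹ (ℚ.↥ ε) {{ℚ.positive 0<ε}}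

-- If q < p, take m strictly between them; then ε = m - q yields p ≤ m < p.
p≤q+ε⇒p≤q : ∀ {p q} → (∀ ε → 0ℚ ℚ.< ε → p ℚ.≤ q ℚ.+ ε) → p ℚ.≤ q
p≤q+ε⇒p≤q {p} {q} p≤q+ε = ℚP.≮⇒≥ λ q<p →
  let m , q<m , m<p = ℚP.<-dense q<p
      0<m-q = subst (ℚ._< m ℚ.- q) (ℚP.+-inverseʳ q) (ℚP.+-monoˡ-< (ℚ.- q) q<m)
      q+[m-q]≡m = trans (ℚP.+-comm q (m ℚ.- q)) (trans (ℚP.+-assoc m (ℚ.- q) q)
        (trans (cong (m ℚ.+_) (ℚP.+-inverseˡ q)) (ℚP.+-identityʳ m)))
  in ℚP.<-irrefl refl (ℚP.≤-<-trans
       (subst (p ℚ.≤_) q+[m-q]≡m (p≤q+ε (m ℚ.- q) 0<m-q)) m<p)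

-- Turns the density hypothesis into one on naturals: positivity of δ bounds its late terms below by
-- some 1/(1+a), and `D` is 1 + a.
δ*c≤l⇒c≤l*D : ∀ δ → 0ℝ < δ →
  ∃ λ D → ∀ c l → δ * fromℕ c ≤ fromℕ l → c ℕ.≤ l ℕ.* D
δ*c≤l⇒c≤l*D δ (ε , 0<ε , N₁ , ε≤δ) with unitFraction≤ ε 0<ε
... | a , 1/a≤ε = suc a , λ c l δc≤l → unitFraction*≤⁻ a c l (p≤q+ε⇒p≤q λ η 0<η →
  let
    N₂ , δc≤l+η = δc≤l η 0<η
    -- A single index at which both eventual inequalities hold.
    m = N₁ ℕ.⊔ N₂
    open ℚP.≤-Reasoning
    1/a≤δ : + 1 ℚ./ suc a ℚ.≤ seq δ m
    1/a≤δ = begin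
      + 1 ℚ./ suc a ≤⟨ 1/a≤ε ⟩
      ε             ≡⟨ ℚP.+-identityˡ ε ⟨
      0ℚ ℚ.+ ε      ≤⟨ ε≤δ m (ℕP.m≤m⊔n N₁ N₂) ⟩
      seq δ m       ∎
  in begin
    (+ 1 ℚ./ suc a) ℚ.* (+ c ℚ./ 1)
      ≤⟨ ℚP.*-monoʳ-≤-nonNeg (+ c ℚ./ 1) {{ℚP.normalize-nonNeg c 1}} 1/a≤δ ⟩
    seq δ m ℚ.* (+ c ℚ./ 1)
      ≤⟨ δc≤l+η m (ℕP.m≤n⊔m N₁ N₂) ⟩
    (+ l ℚ./ 1) ℚ.+ η ∎)

≤-const : ∀ {p q} → p ℚ.≤ q → fromℚ p ≤ fromℚ q
≤-const {p} {q} p≤q ε 0<ε = 0 , λ _ _ → subst (ℚ._≤ q ℚ.+ ε) (ℚP.+-identityʳ p)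
  (ℚP.+-mono-≤ p≤q (ℚP.<⇒≤ 0<ε))

-- Choice of constants and conclusion

separated⇒subsequences : ∀ {n k} {Y : Vector (Subset n) k} → Separated Y →
  ∀ τ → IsTransversal Y τ → IsSubsequence τ
separated⇒subsequences sep τ τ∈Y {i} {j} i<j = sep i<j (τ∈Y i) (τ∈Y j)

-- With a = K D k, few transversals would give n n^k ≤ n K C(n,k) ≤ K D n l ≤ t a n^k, where l is
-- the length of the covering list. Hence n ≤ t a, against the choice of t.
manyTransversals⇒separatedParts : ∀ {n k} K D → .{{ℕ.NonZero n}} →
  n ℕ.^ k ℕ.≤ K ℕ.* (n C k) →
  (X : Vector (Subset n) k) (τs : List (Vec (Fin n) k)) → Unique τs →
  All (λ τ → IsTransversal X τ × IsSubsequence τ) τs →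
  (n C k) ℕ.≤ length τs ℕ.* D →
  ∃ λ Y → (∀ i → Y i ⊆ X i) ×
    (∀ i → n ℕ.≤ ∣ Y i ∣ ℕ.* suc (K ℕ.* D ℕ.* k)) × Separated Y
manyTransversals⇒separatedParts {suc m} {k} K D n^k≤ X τs τs! τs-good many
  -- Rounding down (n-1)/(1+a) gives both t (1+a) < n, for the contradiction, and n ≤ (t+1)(1+a),
  -- for the size of the parts. The successor keeps the divisor nonzero.
  with separatedParts⊎fewTransversals X (m ℕ./ suc (K ℕ.* D ℕ.* k))
... | inj₁ (Y , Y⊆ , large , sep) = Y , Y⊆ , (λ i → n≤ (large i)) , sep
  where
  open ℕP.≤-Reasoning
  a = K ℕ.* D ℕ.* k
  n≤ : ∀ {y} → m ℕ./ suc a ℕ.< y → suc m ℕ.≤ y ℕ.* suc a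
  n≤ {y} t<y = begin-strict
    m                                         ≡⟨ m≡m%n+[m/n]*n m (suc a) ⟩
    m ℕ.% suc a ℕ.+ m ℕ./ suc a ℕ.* suc a     <⟨ ℕP.+-monoˡ-< _ (m%n<n m (suc a)) ⟩
    suc (m ℕ./ suc a) ℕ.* suc a               ≤⟨ ℕP.*-monoˡ-≤ (suc a) t<y ⟩
    y ℕ.* suc a                               ∎
... | inj₂ (σs , few , covers) = contradiction n≤m (ℕP.1+n≰n {m})
  where
  open ℕP.≤-Reasoning
  a = K ℕ.* D ℕ.* k
  n = suc m
  t = m ℕ./ suc a
  ∣τs∣≤∣σs∣ : length τs ℕ.≤ length σs
  -- `σs` may contain repetitions; only the distinctness of `τs` matters.
  ∣τs∣≤∣σs∣ = unique⇒length≤ τs! λ τ∈τs →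
    let τ∈X , τ< = All.lookup τs-good τ∈τs in covers τ∈X τ<
  n*n^k≤ : n ℕ.* n ℕ.^ k ℕ.≤ t ℕ.* a ℕ.* n ℕ.^ k
  n*n^k≤ = begin
    n ℕ.* n ℕ.^ k
      ≤⟨ ℕP.*-monoʳ-≤ n n^k≤ ⟩
    n ℕ.* (K ℕ.* (n C k))
      ≤⟨ ℕP.*-monoʳ-≤ n (ℕP.*-monoʳ-≤ K many) ⟩
    n ℕ.* (K ℕ.* (length τs ℕ.* D))
      ≤⟨ ℕP.*-monoʳ-≤ n (ℕP.*-monoʳ-≤ K (ℕP.*-monoˡ-≤ D ∣τs∣≤∣σs∣)) ⟩
    n ℕ.* (K ℕ.* (length σs ℕ.* D))
      ≡⟨ solve 4 (λ n K l D → n :* (K :* (l :* D)) := K :* D :* (n :* l))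
           refl n K (length σs) D ⟩
    K ℕ.* D ℕ.* (n ℕ.* length σs)
      ≤⟨ ℕP.*-monoʳ-≤ (K ℕ.* D) few ⟩
    K ℕ.* D ℕ.* (k ℕ.* t ℕ.* n ℕ.^ k)
      ≡⟨ solve 4 (λ c k t p → c :* (k :* t :* p) := t :* (c :* k) :* p)
           refl (K ℕ.* D) k t (n ℕ.^ k) ⟩
    t ℕ.* a ℕ.* n ℕ.^ k ∎
    where open +-*-Solver
  n≤m : n ℕ.≤ m
  n≤m = begin
    n           ≤⟨ ℕP.*-cancelʳ-≤ n (t ℕ.* a) (n ℕ.^ k) {{ℕP.m^n≢0 n k}} n*n^k≤ ⟩
    t ℕ.* a     ≤⟨ ℕP.*-monoʳ-≤ t (ℕP.n≤1+n a) ⟩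
    t ℕ.* suc a ≤⟨ m/n*n≤m m (suc a) ⟩
    m           ∎

lemma5 : ∀ (d k : ℕ) → 1 ℕ.≤ d → 1 ℕ.≤ k → (δ : ℝ) → 0ℝ < δ →
    ∃ λ (α : ℝ) → 0ℝ < α ×
    (∀ (n : ℕ) → k ℕ.≤ n →
    (P : Vector (Point d) n) → GeneralPosition P →
    (ρ : Vector (Point d) k) → GeneralPosition ρ →
    (X : Vector (Subset n) k) → PairwiseDisjoint X →
    HasTypeTransversals P ρ X →
    AtLeast (δ * fromℕ (n C k)) (λ τ → IsTransversal X τ × IsSubsequence τ) →
    ∃ λ (Y : Vector (Subset n) k) →
    (∀ i → Y i ⊆ X i) ×
    (∀ i → α * fromℕ n ≤ fromℕ ∣ Y i ∣) ×
    HasTypeTransversalsWrt P ρ Y)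
lemma5 d k _ 1≤k δ 0<δ =
  let
    D , toℕ≤ = δ*c≤l⇒c≤l*D δ 0<δ
    K , n^k≤ = n^k≤K*nCk k
    -- `K` comes from `k` and `D` from `δ`, so α = 1/(1+a) is fixed before n, the points and the
    -- sets.
    a        = K ℕ.* D ℕ.* k
    1/a      = + 1 ℚ./ suc a
  in fromℚ 1/a ,
     (1/a , 0<unitFraction a , 0 , λ _ _ → ℚP.≤-reflexive (ℚP.+-identityˡ 1/a)) ,
     λ n k≤n P _ ρ _ X _ X-type (τs , τs! , τs-good , many) →
       let
         Y , Y⊆X , large , Y-separated = manyTransversals⇒separatedParts K D
           {{ℕ.>-nonZero (ℕP.≤-trans 1≤k k≤n)}} (n^k≤ n k≤n)
           X τs τs! τs-good (toℕ≤ (n C k) (length τs) many)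
       in Y , Y⊆X ,
          (λ i → ≤-const (unitFraction*≤⁺ a n ∣ Y i ∣ (large i))) ,
          (λ τ τ∈Y → X-type τ (λ i → Y⊆X i (τ∈Y i))) ,
          separated⇒subsequences Y-separated
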